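{- Let $\perp^{d}$ be Shelah-dividing independence and let $\perp^{\Xi}$ be the relation of $\Xi$-dividing independence for the set $\Xi$ of all inconsistency pairs. Then $\perp^{d}=\perp^{\Xi}$, i.e. for all sets $A,B,C$: $A\perp^{d}_CB\iff A\perp^{\Xi}_CB$.
   Context: $T$ is a complete consistent first-order theory (possibly many-sorted); we work in a big saturated model of $T$. All sets are small subsets of the big model; $BC$ means $B\cup C$. Tuples may be infinite; a tuple also denotes the set of its entries, and $\bar a\in A$ means that all entries of $\bar a$ lie in $A$. $A\equiv_BA'$ means that some automorphism of the big model fixing $B$ pointwise maps the set $A$ onto $A'$. Shelah-dividing independence: $A\perp^{d}_CB$ iff for any sequence $(\bar b_i)_{i<\omega}$ of $C$-indiscernibles with $\bar b_0\in BC$ there is $A'\equiv_{BC}A$ such that $(\bar b_i)_{i<\omega}$ is indiscernible over $A'C$. Inconsistency pairs: for a formula $\varphi(\bar x;\bar y)$ whose free variables are partitioned into two blocks, a parameter-free formula $\psi(\bar y_0,\dots,\bar y_{k-1})$ is a $k$-inconsistency witness for $\varphi(\bar x;\bar y)$ if $\big(\bigwedge_{i<k}\varphi(\bar x;\bar y_i)\big)\wedge\psi(\bar y_0,\dots,\bar y_{k-1})$ is inconsistent. $\Xi$ is the set of all pairs $(\varphi,\psi)$ such that, for some $k<\omega$, $\psi$ is a $k$-inconsistency witness for $\varphi$. For $(\varphi,\psi)\in\Xi$, a formula $\varphi(\bar x;\bar b)$ $(\varphi,\psi)$-divides over $C$ if there is a sequence $(\bar b_i)_{i<\omega}$ such that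 each $\bar b_i$ realises $\operatorname{tp}(\bar b/C)$ and $\models\psi(\bar b_{i_0},\dots,\bar b_{i_{k-1}})$ for all $i_0<\dots<i_{k-1}<\omega$. A partial type $\Xi$-divides over $C$ if for some $(\varphi,\psi)\in\Xi$ it contains a formula $\varphi(\bar x;\bar b)$ that $(\varphi,\psi)$-divides over $C$. Define $A\perp^{\Xi}_CB$ iff there is no $\bar a\in A$ such that $\operatorname{tp}(\bar a/BC)$ $\Xi$-divides over $C$.
   Formalization: In the definition of Shelah-dividing independence, A′ is required to be conjugate to A over C and the entries of b̄₀ rather than over all of BC; with BC the claim fails, e.g. in the random graph with C empty and B containing the first two terms of the sequence. -}

module Defs where

open import Level using (Level; _⊔_; suc; Lift; 0ℓ)
open import Data.Empty.Polymorphic using (⊥)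
open import Data.Fin.Base using (Fin) renaming (_<_ to _<ᶠ_)
open import Data.List.Base using (List; []; _∷_)
open import Data.List.Membership.Propositional using () renaming (_∈_ to _∈ˡ_)
open import Data.List.Relation.Unary.All as All using (All; []; _∷_)
open import Data.Nat.Base using (ℕ) renaming (_<_ to _<ⁿ_)
open import Data.Product.Base using (Σ; ∃; ∃-syntax; Σ-syntax; _×_; _,_; proj₁; proj₂)
open import Data.Sum.Base using (_⊎_; [_,_]; map₂)
open import Function.Base using (_∘_)
open import Function.Bundles using (_⇔_)
open import Relation.Binary.Core using (_Preserves_⟶_)
open import Relation.Binary.PropositionalEquality.Core using (_≡_)
open import Relation.Nullary.Negation.Core using (¬_)
open import Relation.Unary using (Pred; _∈_; _⊆_; _∪_; _≐_; ∅)

record Language (ℓ : Level) : Set (suc ℓ) where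
  field
    Sort : Set ℓ
    Fun  : Set ℓ
    dom  : Fun → List Sort
    cod  : Fun → Sort
    Rel  : Set ℓ
    ar   : Rel → List Sort

module Syntax {ℓ} (L : Language ℓ) where
  open Language L

  -- A block of variables, given by the variables of each sort.  A block may
  -- be infinite; a formula uses only finitely many of its variables.
  Vars : ∀ v → Set (ℓ ⊔ suc v)
  Vars v = Sort → Set v

  -- V holds the free variables; Γ lists the sorts of the enclosing
  -- quantifiers (de Bruijn).
  data Term {v} (V : Vars v) (Γ : List Sort) : Sort → Set (ℓ ⊔ v) where
    free  : ∀ {s} → V s → Term V Γ s
    bound : ∀ {s} → s ∈ˡ Γ → Term V Γ s
    fun   : (f : Fun) → All (Term V Γ) (dom f) → Term V Γ (cod f)

  infix  8 _≈_
  infixr 7 _∧_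
  infixr 6 _∨_
  infixr 5 _⇒_

  data Formulaᵇ {v} (V : Vars v) (Γ : List Sort) : Set (ℓ ⊔ v) where
    _≈_         : ∀ {s} → Term V Γ s → Term V Γ s → Formulaᵇ V Γ
    rel         : (R : Rel) → All (Term V Γ) (ar R) → Formulaᵇ V Γ
    ⊥ᶠ          : Formulaᵇ V Γ
    _∧_ _∨_ _⇒_ : Formulaᵇ V Γ → Formulaᵇ V Γ → Formulaᵇ V Γ
    all ex      : (s : Sort) → Formulaᵇ V (s ∷ Γ) → Formulaᵇ V Γ

  Formula : ∀ {v} → Vars v → Set (ℓ ⊔ v)
  Formula V = Formulaᵇ V []

  Sentence : Set ℓ
  Sentence = Formula {0ℓ} ∅

  module _ {v w} {V : Vars v} {W : Vars w} (ρ : ∀ s → V s → W s) where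

    renameTerm  : ∀ {Γ s} → Term V Γ s → Term W Γ s
    renameTerms : ∀ {Γ ss} → All (Term V Γ) ss → All (Term W Γ) ss
    renameTerm (free x)   = free (ρ _ x)
    renameTerm (bound i)  = bound i
    renameTerm (fun f ts) = fun f (renameTerms ts)
    renameTerms []       = []
    renameTerms (t ∷ ts) = renameTerm t ∷ renameTerms ts

    rename : ∀ {Γ} → Formulaᵇ V Γ → Formulaᵇ W Γ
    rename (t ≈ u)    = renameTerm t ≈ renameTerm u
    rename (rel R ts) = rel R (renameTerms ts)
    rename ⊥ᶠ         = ⊥ᶠ
    rename (φ ∧ ψ)    = rename φ ∧ rename ψ
    rename (φ ∨ ψ)    = rename φ ∨ rename ψ
    rename (φ ⇒ ψ)    = rename φ ⇒ rename ψ
    rename (all s φ)  = all s (rename φ)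
    rename (ex s φ)   = ex s (rename φ)

  -- n copies ȳ₀, …, ȳₙ₋₁ of a block ȳ.
  Copies : ∀ {v} → ℕ → Vars v → Vars v
  Copies n Y s = Fin n × Y s

module _ {ℓ} (L : Language ℓ) where
  open Language L

  record Structure (m : Level) : Set (ℓ ⊔ suc m) where
    field
      Carrier : Sort → Set m
      funᴵ    : (f : Fun) → All Carrier (dom f) → Carrier (cod f)
      relᴵ    : (R : Rel) → All Carrier (ar R) → Set m

module Semantics {ℓ} {L : Language ℓ} {m} (M : Structure L m) where
  open Language L
  open Syntax L
  open Structure M

  Tuple : ∀ {v} → Vars v → Set (ℓ ⊔ m ⊔ v)
  Tuple V = ∀ s → V s → Carrier s

  infixr 6 _⌢_
  _⌢_ : ∀ {v w} {V : Vars v} {W : Vars w} → Tuple V → Tuple W → Tuple (V ∪ W)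
  (a ⌢ b) s = [ a s , b s ]

  collate : ∀ {v n} {Y : Vars v} → (Fin n → Tuple Y) → Tuple (Copies n Y)
  collate b s (i , y) = b i s y

  module _ {v} {V : Vars v} (a : Tuple V) where

    evalTerm  : ∀ {Γ s} → All Carrier Γ → Term V Γ s → Carrier s
    evalTerms : ∀ {Γ ss} → All Carrier Γ → All (Term V Γ) ss → All Carrier ss
    evalTerm xs (free x)   = a _ x
    evalTerm xs (bound i)  = All.lookup xs i
    evalTerm xs (fun f ts) = funᴵ f (evalTerms xs ts)
    evalTerms xs []       = []
    evalTerms xs (t ∷ ts) = evalTerm xs t ∷ evalTerms xs ts

    Holds : ∀ {Γ} → All Carrier Γ → Formulaᵇ V Γ → Set m
    Holds xs (t ≈ u)    = evalTerm xs t ≡ evalTerm xs u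
    Holds xs (rel R ts) = relᴵ R (evalTerms xs ts)
    Holds xs ⊥ᶠ         = ⊥
    Holds xs (φ ∧ ψ)    = Holds xs φ × Holds xs ψ
    Holds xs (φ ∨ ψ)    = Holds xs φ ⊎ Holds xs ψ
    Holds xs (φ ⇒ ψ)    = Holds xs φ → Holds xs ψ
    Holds xs (all s φ)  = (x : Carrier s) → Holds (x ∷ xs) φ
    Holds xs (ex s φ)   = ∃[ x ] Holds (x ∷ xs) φ

  infix 4 ⊨_[_] ⊨ˢ_
  ⊨_[_] : ∀ {v} {V : Vars v} → Formula V → Tuple V → Set m
  ⊨ φ [ a ] = Holds a [] φ

  ⊨ˢ_ : Sentence → Set m
  ⊨ˢ σ = ⊨ σ [ (λ _ ()) ]

  -- A subset of the (disjoint) union of the sorts.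
  Subset : Set (ℓ ⊔ suc (ℓ ⊔ m))
  Subset = Pred (∃ Carrier) (ℓ ⊔ m)

  entries : {Y : Vars ℓ} → Tuple Y → Subset
  entries {Y} a (s , x) = Σ[ y ∈ Y s ] a s y ≡ x

  -- ā ∈ A for a tuple ā.
  infix 4 _∈ᵗ_
  _∈ᵗ_ : ∀ {v} {Y : Vars v} → Tuple Y → Subset → Set (ℓ ⊔ m ⊔ v)
  a ∈ᵗ A = ∀ s y → (s , a s y) ∈ A

  -- Small means: enumerated by a family indexed in the universe Set ℓ of the
  -- language.  The carriers live in an independent universe Set m.
  Small : Subset → Set (suc ℓ ⊔ m)
  Small A = Σ[ Y ∈ Vars ℓ ] Σ[ a ∈ Tuple Y ] A ≐ entries a

  -- Constants naming the elements of B, and their interpretation.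
  El : Subset → Vars (ℓ ⊔ m)
  El B s = Σ[ x ∈ Carrier s ] (s , x) ∈ B

  name : (B : Subset) → Tuple (El B)
  name B s = proj₁

  FormulaOver : ∀ {v} → Vars v → Subset → Set (ℓ ⊔ m ⊔ v)
  FormulaOver X B = Formula (X ∪ El B)

  PartialType : ∀ {v} → Vars v → Subset → Set (suc (ℓ ⊔ m) ⊔ v)
  PartialType X B = Pred (FormulaOver X B) (ℓ ⊔ m)

  infix 4 _realises_
  _realises_ : ∀ {v p} {X : Vars v} {B : Subset} →
               Tuple X → Pred (FormulaOver X B) p → Set (ℓ ⊔ m ⊔ v ⊔ p)
  _realises_ {B = B} a p = ∀ φ → φ ∈ p → ⊨ φ [ a ⌢ name B ]

  tp : ∀ {v} {X : Vars v} → Tuple X → (B : Subset) → PartialType X B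
  tp a B φ = Lift ℓ (⊨ φ [ a ⌢ name B ])

  -- The formula φ(x̄;b̄) with parameters b̄ ∈ B obtained from φ(x̄;ȳ).
  _⟨_⟩ : ∀ {v w} {X : Vars v} {Y : Vars w} {B : Subset} →
         Formula (X ∪ Y) → (Σ[ b ∈ Tuple Y ] b ∈ᵗ B) → FormulaOver X B
  φ ⟨ b , b∈B ⟩ = rename (λ s → map₂ (λ y → b s y , b∈B s y)) φ

  record Automorphism : Set (ℓ ⊔ m) where
    field
      to      : ∀ s → Carrier s → Carrier s
      from    : ∀ s → Carrier s → Carrier s
      to∘from : ∀ s x → to s (from s x) ≡ x
      from∘to : ∀ s x → from s (to s x) ≡ x
      fun-hom : ∀ f xs → to (cod f) (funᴵ f xs) ≡ funᴵ f (All.map (to _) xs)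
      rel-hom : ∀ R xs → relᴵ R xs ⇔ relᴵ R (All.map (to _) xs)

  open Automorphism public using (to)

  image : Automorphism → Subset → Subset
  image f A (s , y) = Σ[ x ∈ Carrier s ] (s , x) ∈ A × to f s x ≡ y

  infix 4 _≡[_]_
  _≡[_]_ : Subset → Subset → Subset → Set (ℓ ⊔ m)
  A ≡[ B ] A′ = Σ[ f ∈ Automorphism ]
    (∀ s x → (s , x) ∈ B → to f s x ≡ x) × image f A ≐ A′

  FinitelySatisfiable : ∀ {v} {X : Vars v} {B : Subset} →
                        PartialType X B → Set (ℓ ⊔ m ⊔ v)
  FinitelySatisfiable {X = X} {B} p =
    ∀ φs → All p φs → Σ[ a ∈ Tuple X ] All (λ φ → ⊨ φ [ a ⌢ name B ]) φs

  -- Since tuples may be infinite, types are taken in small tuples of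
  -- variables.
  Saturated : Set (suc (ℓ ⊔ m))
  Saturated = ∀ (X : Vars ℓ) (B : Subset) → Small B → (p : PartialType X B) →
    FinitelySatisfiable p → Σ[ a ∈ Tuple X ] a realises p

  StronglyHomogeneous : Set (suc ℓ ⊔ m)
  StronglyHomogeneous = ∀ (Y : Vars ℓ) (a b : Tuple Y) →
    (∀ φ → ⊨ φ [ a ] ⇔ ⊨ φ [ b ]) →
    Σ[ f ∈ Automorphism ] (∀ s y → to f s (a s y) ≡ b s y)

  StrictlyIncreasing : ∀ {n} → (Fin n → ℕ) → Set
  StrictlyIncreasing i = i Preserves _<ᶠ_ ⟶ _<ⁿ_

  IndiscernibleOver : ∀ {v} {Y : Vars v} → Subset → (ℕ → Tuple Y) → Set (ℓ ⊔ m ⊔ v)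
  IndiscernibleOver D b = ∀ n (i j : Fin n → ℕ) →
    StrictlyIncreasing i → StrictlyIncreasing j →
    tp (collate (b ∘ i)) D ≐ tp (collate (b ∘ j)) D

-- Entailment and consistency refer to models with carriers in Set m.
module _ {ℓ} (L : Language ℓ) (m : Level) where
  open Syntax L
  open Semantics using (⊨ˢ_)

  Models : Structure L m → Pred Sentence ℓ → Set (ℓ ⊔ m)
  Models N T = ∀ σ → σ ∈ T → (⊨ˢ N) σ

  Entails : Pred Sentence ℓ → Sentence → Set (ℓ ⊔ suc m)
  Entails T σ = ∀ N → Models N T → (⊨ˢ N) σ

  record CompleteTheory : Set (suc (ℓ ⊔ m)) where
    field
      Axioms     : Pred Sentence ℓ
      consistent : ∃[ N ] Models N Axioms
      complete   : ∀ σ → Entails Axioms σ ⊎ Entails Axioms (σ ⇒ ⊥ᶠ)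

module _ {ℓ} {L : Language ℓ} {m} (T : CompleteTheory L m) where
  open CompleteTheory T
  open Semantics

  record BigModel : Set (suc (ℓ ⊔ m)) where
    field
      M           : Structure L m
      isModel     : Models L m M Axioms
      saturated   : Saturated M
      homogeneous : StronglyHomogeneous M

module Independence {ℓ} {L : Language ℓ} {m} {T : CompleteTheory L m}
                    (𝕄 : BigModel T) where
  open Syntax L public
  open CompleteTheory T
  open BigModel 𝕄
  open Semantics M public

  -- A ⊥ᵈ[ C ] B.  The conjugate A′ is taken over C b̄₀, the base over which a
  -- sequence starting with b̄₀ is to be made indiscernible.  Demanding
  -- A′ ≡[ B ∪ C ] A for an arbitrary b̄₀ ∈ B ∪ C would be too strong: in the
  -- random graph let C = ∅, let b₀, b₁, … be distinct and pairwise
  -- non-adjacent, B = {b₀, b₁}, and let a be adjacent to b₀ but not to b₁.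
  -- Then tp(a/B) contains no dividing formula, but no conjugate of a over B
  -- makes (bᵢ) indiscernible.  If b̄₀ enumerates B ∪ C the two bases coincide.
  infix 4 _⊥ᵈ[_]_ _⊥Ξ[_]_
  _⊥ᵈ[_]_ : Subset → Subset → Subset → Set (suc (ℓ ⊔ m))
  A ⊥ᵈ[ C ] B = ∀ (Y : Vars ℓ) (b : ℕ → Tuple Y) →
    IndiscernibleOver C b → b 0 ∈ᵗ (B ∪ C) →
    Σ[ A′ ∈ Subset ] A′ ≡[ C ∪ entries (b 0) ] A × IndiscernibleOver (A′ ∪ C) b

  -- Inconsistency is relative to T: no model of T satisfies
  -- ⋀ᵢ φ(x̄;ȳᵢ) ∧ ψ(ȳ₀,…,ȳₖ₋₁).
  InconsistencyWitness : ∀ k {X Y : Vars ℓ} → Formula (X ∪ Y) →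
                         Formula (Copies k Y) → Set (ℓ ⊔ suc m)
  InconsistencyWitness k {X} {Y} φ ψ =
    ∀ (N : Structure L m) → Models L m N Axioms → let module N = Semantics N in
    (a : N.Tuple X) (b : Fin k → N.Tuple Y) →
    ¬ ((∀ i → N.⊨ φ [ a N.⌢ b i ]) × N.⊨ ψ [ N.collate b ])

  record Ξ (X Y : Vars ℓ) : Set (ℓ ⊔ suc m) where
    field
      φ       : Formula (X ∪ Y)
      k       : ℕ
      ψ       : Formula (Copies k Y)
      witness : InconsistencyWitness k φ ψ

  _-dividesOver : ∀ {X Y} → Ξ X Y → Tuple Y → Subset → Set (ℓ ⊔ m)
  _-dividesOver {Y = Y} ξ b C = Σ[ c ∈ (ℕ → Tuple Y) ]
    (∀ i → c i realises tp b C) ×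
    (∀ (i : Fin k → ℕ) → StrictlyIncreasing i → ⊨ ψ [ collate (c ∘ i) ])
    where open Ξ ξ

  ΞDividesOver : ∀ {X D} → PartialType X D → Subset → Set (suc (ℓ ⊔ m))
  ΞDividesOver {X} {D} p C =
    Σ[ Y ∈ Vars ℓ ] Σ[ ξ ∈ Ξ X Y ] Σ[ (b , b∈D) ∈ (Σ[ b ∈ Tuple Y ] b ∈ᵗ D) ]
    (Ξ.φ ξ ⟨ b , b∈D ⟩) ∈ p × (ξ -dividesOver) b C

  _⊥Ξ[_]_ : Subset → Subset → Subset → Set (suc (ℓ ⊔ m))
  A ⊥Ξ[ C ] B = ¬ (Σ[ X ∈ Vars ℓ ] Σ[ a ∈ Tuple X ]
    a ∈ᵗ A × ΞDividesOver (tp a (B ∪ C)) C)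

{-# OPTIONS --safe #-}
module Submission where

-- From ⊥ᵈ to ⊥Ξ: Ramsey's theorem and saturation turn a sequence witnessing
-- that φ(x̄;b̄) divides into a C-indiscernible one, which homogeneity moves so
-- that it starts with b̄.  If it were indiscernible over a realisation of
-- φ(x̄;b̄), that realisation would satisfy φ along the whole sequence, against
-- the inconsistency witness.
--
-- From ⊥Ξ to ⊥ᵈ: let ā enumerate A and p(x̄;b̄₀) = tp(ā/C b̄₀).  The union of
-- all p(x̄;b̄ᵢ) is consistent, since otherwise some φ ∈ p and some k make
-- {φ(x̄;b̄ᵢ) : i < k} inconsistent, and then φ divides with
-- ψ = ¬∃x̄ ⋀ᵢ φ(x̄;ȳᵢ).  Over a realisation ā* of this union, extract from
-- (b̄ᵢ) a sequence indiscernible over C ā*.  It has the type of (b̄ᵢ) over C,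
-- so an automorphism takes it back to (b̄ᵢ), and it takes ā* to an enumeration
-- of the required A′.

open import Defs
open import Axiom.ExcludedMiddle using (ExcludedMiddle)
open import Data.Empty using (⊥-elim)
import Data.Empty.Polymorphic as Polymorphic
open import Data.Fin.Base using (Fin; zero; suc; toℕ; fromℕ<) renaming (_<_ to _<ᶠ_)
open import Data.Fin.Properties using (toℕ-fromℕ<)
open import Data.List.Base using (List; []; _∷_; _++_; map)
open import Data.List.Membership.Propositional using () renaming (_∈_ to _∈ˡ_)
open import Data.List.Membership.Propositional.Properties using (∈-++⁺ˡ; ∈-++⁺ʳ; ∈-map⁺)
open import Data.List.Relation.Unary.All as All using (All; []; _∷_)
open import Data.List.Relation.Unary.All.Properties using (map-id; lookup-map; ++⁺; ++⁻ˡ; ++⁻ʳ)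
open import Data.List.Relation.Unary.Any using (here; there)
open import Data.Nat.Base using (ℕ; zero; suc; _+_; _∸_; _<_; z<s; s<s)
open import Data.Nat.Properties
  using (<-trans; <-≤-trans; n<1+n; m≤m+n; m≤n+m; +-monoʳ-<; ∸-monoˡ-<; m+[n∸m]≡n; m<1+n⇒m<n∨m≡n)
open import Data.Product.Base using (Σ-syntax; ∃; ∃-syntax; _×_; _,_; proj₁; proj₂)
open import Data.Product.Function.Dependent.Propositional using (Σ-⇔)
open import Data.Product.Function.NonDependent.Propositional using (_×-⇔_)
open import Data.Sum.Base using (_⊎_; inj₁; inj₂; [_,_]; [_,_]′; map₁; map₂)
open import Data.Sum.Function.Propositional using (_⊎-⇔_)
open import Data.Vec.Functional using () renaming (_∷_ to _◂_)
open import Function.Base using (_∘_; id)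
open import Function.Bundles using (_⇔_; _↠_; mk⇔; mk↠ₛ; Equivalence; Surjection)
open import Function.Construct.Composition using (_⇔-∘_)
open import Function.Construct.Identity using (⇔-id; ↠-id)
open import Function.Construct.Symmetry using (⇔-sym)
open import Function.Related.TypeIsomorphisms using (→-cong-⇔)
open import Level using (_⊔_; lift; lower)
open import Relation.Binary.Core using (_Preserves_⟶_)
open import Relation.Binary.PropositionalEquality
  using (_≡_; refl; sym; trans; cong; cong₂; subst; _≗_)
open import Relation.Nullary using (¬_; yes; no)
open import Relation.Unary using (Pred; _∈_; _⊆_; _∪_)

-- Ramsey's theorem for two-coloured increasing `n`-tuples.

Increasing : ∀ {n} → (Fin n → ℕ) → Set
Increasing i = i Preserves _<ᶠ_ ⟶ _<_

Monotone : (ℕ → ℕ) → Set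
Monotone g = g Preserves _<_ ⟶ _<_

step⇒monotone : (g : ℕ → ℕ) → (∀ n → g n < g (suc n)) → Monotone g
step⇒monotone g step {s} {suc t} s<1+t with m<1+n⇒m<n∨m≡n s<1+t
... | inj₁ s<t  = <-trans (step⇒monotone g step s<t) (step t)
... | inj₂ refl = step t

module Ramsey (em : ∀ {p} → ExcludedMiddle p) where

  -- Either `C` fails from some point on, and a shift skips the exceptions, or it holds arbitrarily
  -- late, and `g` enumerates such points.
  pigeonhole : ∀ {p} (C : Pred ℕ p) →
    ∃[ g ] Monotone g × (∀ s t → C (g s) → C (g t))
  pigeonhole C with em {P = ∃[ n ] (∀ t → ¬ C (n + t))}
  ... | yes (n , ¬C) = (n +_) , +-monoʳ-< n , λ s _ c → ⊥-elim (¬C s c)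
  ... | no unbounded = g , step⇒monotone g (λ n → m≤m+n (suc (g n)) _) , λ _ t _ → g-C t
    where
    later : ∀ n → ∃[ t ] C (n + t)
    later n with em {P = ∃[ t ] C (n + t)}
    ... | yes p = p
    ... | no ¬p = ⊥-elim (unbounded (n , λ t c → ¬p (t , c)))

    next g : ℕ → ℕ
    next n = n + proj₁ (later n)
    g zero    = next zero
    g (suc n) = next (suc (g n))

    g-C : ∀ n → C (g n)
    g-C zero    = proj₂ (later zero)
    g-C (suc n) = proj₂ (later (suc (g n)))

  -- Index tuples are functions, and splitting one into head and tail recovers it only pointwise.
  Extensional : ∀ {n p} → Pred (Fin n → ℕ) p → Set p
  Extensional P = ∀ {i j} → i ≗ j → P i → P j

  Homogeneous : ∀ {n p} → Pred (Fin n → ℕ) p → (ℕ → ℕ) → Set p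
  Homogeneous P g = ∀ i j → Increasing i → Increasing j → P (g ∘ i) → P (g ∘ j)

  ◂-cong : ∀ {n} x {i j : Fin n → ℕ} → i ≗ j → (x ◂ i) ≗ (x ◂ j)
  ◂-cong x i≗j zero    = refl
  ◂-cong x i≗j (suc k) = i≗j k

  -- Induction on `n`: the result for `n`-tuples makes the colour of an `(n+1)`-tuple depend on its
  -- first point alone, and `pigeonhole` then removes that dependence.
  ramsey : ∀ {p} n (P : Pred (Fin n → ℕ) p) → Extensional P →
    ∃[ g ] Monotone g × Homogeneous P g
  ramsey zero    P ext = id , id , λ i j _ _ → ext λ ()
  ramsey {p} (suc n) P ext =
    x ∘ g , x-mono ∘ g-mono , λ i j i↑ j↑ Pi →
      fromColour (g ∘ j) (g-mono ∘ j↑)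
        (g-hom (i zero) (j zero) (toColour (g ∘ i) (g-mono ∘ i↑) Pi))
    where
    -- h enumerates the points still available; h 0 is chosen, and the rest is
    -- thinned out until P no longer depends on the points chosen after h 0.
    module _ (h : ℕ → ℕ) where
      thin : ∃[ g ] Monotone g × Homogeneous (λ i → P (h 0 ◂ (h ∘ suc ∘ i))) g
      thin = ramsey n _ (λ i≗j → ext (◂-cong _ (cong (h ∘ suc) ∘ i≗j)))

      rest : ℕ → ℕ
      rest = h ∘ suc ∘ proj₁ thin

    -- The diagonal of the successive thinnings, recorded as positions in `h` so that monotonicity
    -- does not involve the values of `h`.
    pos : (ℕ → ℕ) → ℕ → ℕ
    pos h zero    = zero
    pos h (suc t) = suc (proj₁ (thin h) (pos (rest h) t))

    pos-mono : ∀ h → Monotone (pos h)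
    pos-mono h {zero}  {suc t} _         = z<s
    pos-mono h {suc s} {suc t} (s<s s<t) =
      s<s (proj₁ (proj₂ (thin h)) (pos-mono (rest h) s<t))

    chosen : (ℕ → ℕ) → ℕ → ℕ
    chosen h t = h (pos h t)

    after : ℕ → (Fin n → ℕ) → Fin n → ℕ
    after t i k = suc (t + i k)

    endHomogeneous : ∀ h t → Homogeneous (λ i → P (chosen h t ◂ (chosen h ∘ after t i))) id
    endHomogeneous h zero    i j i↑ j↑ =
      proj₂ (proj₂ (thin h)) (pos (rest h) ∘ i) (pos (rest h) ∘ j)
        (pos-mono (rest h) ∘ i↑) (pos-mono (rest h) ∘ j↑)
    -- `chosen h (suc t)` unfolds to `chosen (rest h) t`, so the claim passes to the thinned
    -- sequence.
    endHomogeneous h (suc t) = endHomogeneous (rest h) t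

    x : ℕ → ℕ
    x = chosen id

    x-mono : Monotone x
    x-mono = pos-mono id

    -- By `endHomogeneous` the one sample tail `toℕ` decides `P` for all increasing tails after
    -- `x t`.
    Colour : Pred ℕ p
    Colour t = P (x t ◂ (x ∘ after t toℕ))

    g      = proj₁ (pigeonhole Colour)
    g-mono = proj₁ (proj₂ (pigeonhole Colour))
    g-hom  = proj₂ (proj₂ (pigeonhole Colour))

    module _ (i : Fin (suc n) → ℕ) (i↑ : Increasing i) where
      -- The offset `suc` matches `after`, which counts from the point following the head.
      gap : Fin n → ℕ
      gap k = i (suc k) ∸ suc (i zero)

      gap↑ : Increasing gap
      gap↑ {k} k<l = ∸-monoˡ-< (i↑ (s<s k<l)) (i↑ {zero} {suc k} z<s)

      split : x ∘ i ≗ (x (i zero) ◂ (x ∘ after (i zero) gap))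
      split zero    = refl
      split (suc k) = cong x (sym (m+[n∸m]≡n (i↑ {zero} {suc k} z<s)))

      toColour : P (x ∘ i) → Colour (i zero)
      toColour = endHomogeneous id (i zero) gap toℕ gap↑ id ∘ ext split

      fromColour : Colour (i zero) → P (x ∘ i)
      fromColour = ext (sym ∘ split) ∘ endHomogeneous id (i zero) toℕ gap id gap↑

-- Equivalences under quantifiers, equality and substitution.

Π-⇔ : ∀ {a b p q} {A : Set a} {B : Set b} {P : A → Set p} {Q : B → Set q}
  (A↠B : A ↠ B) → (∀ {x} → P x ⇔ Q (Surjection.to A↠B x)) →
  (∀ x → P x) ⇔ (∀ y → Q y)
Π-⇔ {Q = Q} A↠B P⇔Q = mk⇔
  (λ p y → let x , eq = strictlySurjective y in subst Q eq (Equivalence.to P⇔Q (p x)))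
  (λ q x → Equivalence.from P⇔Q (q (to x)))
  where open Surjection A↠B

≡-⇔ : ∀ {a} {A : Set a} {x y x′ y′ : A} → x ≡ x′ → y ≡ y′ → (x ≡ y) ⇔ (x′ ≡ y′)
≡-⇔ refl refl = ⇔-id _

subst-⇔ : ∀ {a p} {A : Set a} (P : A → Set p) {x y : A} → x ≡ y → P x ⇔ P y
subst-⇔ P refl = ⇔-id _

ω-Copies : ∀ {s v} {Sort : Set s} → (Sort → Set v) → Sort → Set v
ω-Copies Y s = ℕ × Y s

-- Occurring variables, their reassignment, and finite quantifier prefixes.

module _ {ℓ} {L : Language ℓ} where
  open Language L
  open Syntax L

  module _ {v} {V : Vars v} where
    support      : ∀ {Γ} → Formulaᵇ V Γ → List (∃ V)
    supportTerm  : ∀ {Γ s} → Term V Γ s → List (∃ V)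
    supportTerms : ∀ {Γ ss} → All (Term V Γ) ss → List (∃ V)
    supportTerm (free x)   = (_ , x) ∷ []
    supportTerm (bound i)  = []
    supportTerm (fun f ts) = supportTerms ts
    supportTerms []       = []
    supportTerms (t ∷ ts) = supportTerm t ++ supportTerms ts
    support (t ≈ u)    = supportTerm t ++ supportTerm u
    support (rel R ts) = supportTerms ts
    support ⊥ᶠ         = []
    support (φ ∧ ψ)    = support φ ++ support ψ
    support (φ ∨ ψ)    = support φ ++ support ψ
    support (φ ⇒ ψ)    = support φ ++ support ψ
    support (all s φ)  = support φ
    support (ex s φ)   = support φ

  -- An assignment is only required on the variables that occur; hence the
  -- infinitely many others can be dropped, or left out of a quantifier prefix.
  module _ {v w} {V : Vars v} {W : Vars w} {Δ : List Sort} where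
    Assignment : List (∃ V) → Set _
    Assignment xs = ∀ s x → (s , x) ∈ˡ xs → W s ⊎ (s ∈ˡ Δ)

    reassignTerm  : ∀ {Γ s} (t : Term V Γ s) → Assignment (supportTerm t) → Term W (Γ ++ Δ) s
    reassignTerms : ∀ {Γ ss} (ts : All (Term V Γ) ss) → Assignment (supportTerms ts) → All (Term W (Γ ++ Δ)) ss
    reassignTerm {Γ} (free x) σ = [ free , bound ∘ ∈-++⁺ʳ Γ ]′ (σ _ x (here refl))
    reassignTerm (bound i)  σ = bound (∈-++⁺ˡ i)
    reassignTerm (fun f ts) σ = fun f (reassignTerms ts σ)
    reassignTerms []       σ = []
    reassignTerms (t ∷ ts) σ =
      reassignTerm t (λ s x → σ s x ∘ ∈-++⁺ˡ) ∷
      reassignTerms ts (λ s x → σ s x ∘ ∈-++⁺ʳ (supportTerm t))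

    reassign : ∀ {Γ} (φ : Formulaᵇ V Γ) → Assignment (support φ) → Formulaᵇ W (Γ ++ Δ)
    reassign (t ≈ u) σ =
      reassignTerm t (λ s x → σ s x ∘ ∈-++⁺ˡ) ≈
      reassignTerm u (λ s x → σ s x ∘ ∈-++⁺ʳ (supportTerm t))
    reassign (rel R ts) σ = rel R (reassignTerms ts σ)
    reassign ⊥ᶠ         σ = ⊥ᶠ
    reassign (φ ∧ ψ)    σ =
      reassign φ (λ s x → σ s x ∘ ∈-++⁺ˡ) ∧
      reassign ψ (λ s x → σ s x ∘ ∈-++⁺ʳ (support φ))
    reassign (φ ∨ ψ)    σ =
      reassign φ (λ s x → σ s x ∘ ∈-++⁺ˡ) ∨
      reassign ψ (λ s x → σ s x ∘ ∈-++⁺ʳ (support φ))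
    reassign (φ ⇒ ψ)    σ =
      reassign φ (λ s x → σ s x ∘ ∈-++⁺ˡ) ⇒
      reassign ψ (λ s x → σ s x ∘ ∈-++⁺ʳ (support φ))
    reassign (all s φ)  σ = all s (reassign φ σ)
    reassign (ex s φ)   σ = ex s (reassign φ σ)

  exs : ∀ {v} {V : Vars v} Δ → Formulaᵇ V Δ → Formula V
  exs []      φ = φ
  exs (s ∷ Δ) φ = exs Δ (ex s φ)

  ⊤ᶠ : ∀ {v} {V : Vars v} → Formula V
  ⊤ᶠ = ⊥ᶠ ⇒ ⊥ᶠ

  ⋀ : ∀ {v} {V : Vars v} n → (Fin n → Formula V) → Formula V
  ⋀ zero    φ = ⊤ᶠ
  ⋀ (suc n) φ = φ zero ∧ ⋀ n (φ ∘ suc)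

-- Truth under renaming, automorphisms and reassignment.

module Truth {ℓ} {L : Language ℓ} {m} (M : Structure L m) where
  open Language L
  open Syntax L
  open Structure M
  open Semantics M

  module _ (f : Automorphism) {v w} {V : Vars v} {W : Vars w} {ρ : ∀ s → V s → W s}
    {a : Tuple V} {b : Tuple W} (b∘ρ≡f∘a : ∀ s x → b s (ρ s x) ≡ to f s (a s x)) where

    transportTerm : ∀ {Γ s} (γ : All Carrier Γ) (t : Term V Γ s) →
      evalTerm b (All.map (to f _) γ) (renameTerm ρ t) ≡ to f s (evalTerm a γ t)
    transportTerms : ∀ {Γ ss} (γ : All Carrier Γ) (ts : All (Term V Γ) ss) →
      evalTerms b (All.map (to f _) γ) (renameTerms ρ ts) ≡ All.map (to f _) (evalTerms a γ ts)
    transportTerm γ (free x)   = b∘ρ≡f∘a _ x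
    transportTerm γ (bound i)  = lookup-map γ i
    transportTerm γ (fun g ts) =
      trans (cong (funᴵ g) (transportTerms γ ts)) (sym (Automorphism.fun-hom f g _))
    transportTerms γ []       = refl
    transportTerms γ (t ∷ ts) = cong₂ _∷_ (transportTerm γ t) (transportTerms γ ts)

    -- Renaming and automorphism share one induction: the identity automorphism yields `rename-⇔`,
    -- the identity renaming yields `automorphism-⇔`. Surjectivity of the automorphism handles
    -- quantifiers, injectivity handles equality.
    transport : ∀ {Γ} (γ : All Carrier Γ) (φ : Formulaᵇ V Γ) →
      Holds a γ φ ⇔ Holds b (All.map (to f _) γ) (rename ρ φ)
    transport γ (t ≈ u) = mk⇔
      (λ eq → trans (transportTerm γ t) (trans (cong (to f _) eq) (sym (transportTerm γ u))))
      (λ eq → trans (sym (from∘to _ _)) (trans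
        (cong (from _) (trans (sym (transportTerm γ t)) (trans eq (transportTerm γ u))))
        (from∘to _ _)))
      where open Automorphism f using (from; from∘to)
    transport γ (rel R ts) =
      subst-⇔ (relᴵ R) (sym (transportTerms γ ts)) ⇔-∘ Automorphism.rel-hom f R _
    transport γ ⊥ᶠ         = ⇔-id _
    transport γ (φ ∧ ψ)    = transport γ φ ×-⇔ transport γ ψ
    transport γ (φ ∨ ψ)    = transport γ φ ⊎-⇔ transport γ ψ
    transport γ (φ ⇒ ψ)    = →-cong-⇔ (transport γ φ) (transport γ ψ)
    transport γ (all s φ)  = Π-⇔ (mk↠ₛ λ y → _ , Automorphism.to∘from f s y) (transport (_ ∷ γ) φ)
    transport γ (ex s φ)   = Σ-⇔ (mk↠ₛ λ y → _ , Automorphism.to∘from f s y) (transport (_ ∷ γ) φ)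

  identity : Automorphism
  identity = record
    { to      = λ _ → id
    ; from    = λ _ → id
    ; to∘from = λ _ _ → refl
    ; from∘to = λ _ _ → refl
    ; fun-hom = λ f xs → cong (funᴵ f) (sym (map-id xs))
    ; rel-hom = λ R xs → subst-⇔ (relᴵ R) (sym (map-id xs))
    }

  module _ {v w} {V : Vars v} {W : Vars w} {ρ : ∀ s → V s → W s} {a : Tuple V} {b : Tuple W} where

    rename-⇔ : (∀ s x → b s (ρ s x) ≡ a s x) → ∀ φ → ⊨ φ [ a ] ⇔ ⊨ rename ρ φ [ b ]
    rename-⇔ eq = transport identity eq []

  module _ {v} {V : Vars v} {a b : Tuple V} where

    automorphism-⇔ : ∀ f → (∀ s x → to f s (a s x) ≡ b s x) → ∀ φ → ⊨ φ [ a ] ⇔ ⊨ φ [ b ]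
    automorphism-⇔ f eq φ =
      -- Renaming along the identity does not reduce on an arbitrary `φ`, so a second renaming step
      -- removes it.
      ⇔-sym (rename-⇔ {ρ = λ _ → id} (λ _ _ → refl) φ) ⇔-∘ transport f (λ s x → sym (eq s x)) [] φ

    cong-⇔ : (∀ s x → a s x ≡ b s x) → ∀ φ → ⊨ φ [ a ] ⇔ ⊨ φ [ b ]
    cong-⇔ = automorphism-⇔ identity

  lookup-++⁺ˡ : ∀ {Γ Δ s} (γ : All Carrier Γ) (δ : All Carrier Δ) (i : s ∈ˡ Γ) →
    All.lookup (++⁺ γ δ) (∈-++⁺ˡ i) ≡ All.lookup γ i
  lookup-++⁺ˡ (x ∷ γ) δ (here refl) = refl
  lookup-++⁺ˡ (x ∷ γ) δ (there i)   = lookup-++⁺ˡ γ δ i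

  lookup-++⁺ʳ : ∀ {Γ Δ s} (γ : All Carrier Γ) (δ : All Carrier Δ) (i : s ∈ˡ Δ) →
    All.lookup (++⁺ γ δ) (∈-++⁺ʳ Γ i) ≡ All.lookup δ i
  lookup-++⁺ʳ []      δ i = refl
  lookup-++⁺ʳ (x ∷ γ) δ i = lookup-++⁺ʳ γ δ i

  module _ {v w} {V : Vars v} {W : Vars w} {Δ} (a : Tuple V) (b : Tuple W) (δ : All Carrier Δ) where

    Evaluates : ∀ xs → Assignment {L = L} {V = V} {W} {Δ} xs → Set (v ⊔ ℓ ⊔ m)
    Evaluates xs σ = ∀ s x (x∈ : (s , x) ∈ˡ xs) → [ b s , All.lookup δ ] (σ s x x∈) ≡ a s x

    reassignTerm-≡ : ∀ {Γ s} (γ : All Carrier Γ) (t : Term V Γ s) σ → Evaluates (supportTerm t) σ →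
      evalTerm b (++⁺ γ δ) (reassignTerm t σ) ≡ evalTerm a γ t
    reassignTerms-≡ : ∀ {Γ ss} (γ : All Carrier Γ) (ts : All (Term V Γ) ss) σ → Evaluates (supportTerms ts) σ →
      evalTerms b (++⁺ γ δ) (reassignTerms ts σ) ≡ evalTerms a γ ts
    reassignTerm-≡ γ (free x) σ ev with σ _ x (here refl) | ev _ x (here refl)
    ... | inj₁ y | eq = eq
    ... | inj₂ i | eq = trans (lookup-++⁺ʳ γ δ i) eq
    reassignTerm-≡ γ (bound i)  σ ev = lookup-++⁺ˡ γ δ i
    reassignTerm-≡ γ (fun f ts) σ ev = cong (funᴵ f) (reassignTerms-≡ γ ts σ ev)
    reassignTerms-≡ γ []       σ ev = refl
    reassignTerms-≡ γ (t ∷ ts) σ ev = cong₂ _∷_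
      (reassignTerm-≡ γ t _ (λ s x → ev s x ∘ ∈-++⁺ˡ))
      (reassignTerms-≡ γ ts _ (λ s x → ev s x ∘ ∈-++⁺ʳ (supportTerm t)))

    reassign-⇔ : ∀ {Γ} (γ : All Carrier Γ) (φ : Formulaᵇ V Γ) σ → Evaluates (support φ) σ →
      Holds b (++⁺ γ δ) (reassign φ σ) ⇔ Holds a γ φ
    reassign-⇔ γ (t ≈ u) σ ev = ≡-⇔
      (reassignTerm-≡ γ t _ (λ s x → ev s x ∘ ∈-++⁺ˡ))
      (reassignTerm-≡ γ u _ (λ s x → ev s x ∘ ∈-++⁺ʳ (supportTerm t)))
    reassign-⇔ γ (rel R ts) σ ev = subst-⇔ (relᴵ R) (reassignTerms-≡ γ ts σ ev)
    reassign-⇔ γ ⊥ᶠ σ ev = ⇔-id _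
    reassign-⇔ γ (φ ∧ ψ) σ ev =
      reassign-⇔ γ φ _ (λ s x → ev s x ∘ ∈-++⁺ˡ) ×-⇔
      reassign-⇔ γ ψ _ (λ s x → ev s x ∘ ∈-++⁺ʳ (support φ))
    reassign-⇔ γ (φ ∨ ψ) σ ev =
      reassign-⇔ γ φ _ (λ s x → ev s x ∘ ∈-++⁺ˡ) ⊎-⇔
      reassign-⇔ γ ψ _ (λ s x → ev s x ∘ ∈-++⁺ʳ (support φ))
    reassign-⇔ γ (φ ⇒ ψ) σ ev = →-cong-⇔
      (reassign-⇔ γ φ _ (λ s x → ev s x ∘ ∈-++⁺ˡ))
      (reassign-⇔ γ ψ _ (λ s x → ev s x ∘ ∈-++⁺ʳ (support φ)))
    reassign-⇔ γ (all s φ) σ ev = Π-⇔ (↠-id _) (reassign-⇔ (_ ∷ γ) φ σ ev)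
    reassign-⇔ γ (ex s φ) σ ev = Σ-⇔ (↠-id _) (reassign-⇔ (_ ∷ γ) φ σ ev)

  exs-⇔ : ∀ {v} {V : Vars v} (a : Tuple V) Δ (φ : Formulaᵇ V Δ) →
    ⊨ exs Δ φ [ a ] ⇔ (∃[ δ ] Holds a δ φ)
  exs-⇔ a []      φ = mk⇔ ([] ,_) λ { ([] , h) → h }
  exs-⇔ a (s ∷ Δ) φ = mk⇔ (λ { (δ , x , h) → x ∷ δ , h }) (λ { (x ∷ δ , h) → δ , x , h })
    ⇔-∘ exs-⇔ a Δ (ex s φ)

  ⋀-⇔ : ∀ {v} {V : Vars v} (a : Tuple V) n φ → ⊨ ⋀ n φ [ a ] ⇔ (∀ i → ⊨ φ i [ a ])
  ⋀-⇔ a zero    φ = mk⇔ (λ _ ()) (λ _ → id)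
  ⋀-⇔ a (suc n) φ = mk⇔ (λ { (h , hs) zero → h ; (h , hs) (suc i) → Equivalence.to (⋀-⇔ a n _) hs i })
    (λ h → h zero , Equivalence.from (⋀-⇔ a n _) (h ∘ suc))

  bounded : ∀ {a} {A : Set a} (f : A → ℕ) (xs : List A) → ∃[ n ] (∀ x → x ∈ˡ xs → f x < n)
  bounded f []       = 0 , λ _ ()
  bounded f (x ∷ xs) = let n , lt = bounded f xs in suc (f x) + n , λ where
    _ (here refl) → m≤m+n (suc (f x)) n
    y (there y∈)  → <-≤-trans (lt y y∈) (m≤n+m n (suc (f x)))

  spread : ∀ {v} {Y : Vars v} → (ℕ → Tuple Y) → Tuple (ω-Copies Y)
  spread b s (i , y) = b i s y

  -- Finitely many variables occur, so their copy indices are bounded. This lets indiscernibility,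
  -- which concerns finite tuples of indices, control the type of a whole sequence.
  truncate : ∀ {v w} {Y : Vars v} {Z : Vars w} (φ : Formula (ω-Copies Y ∪ Z)) →
    ∃[ n ] Σ[ φ′ ∈ Formula (Copies n Y ∪ Z) ] (∀ (b : ℕ → Tuple Y) (c : Tuple Z) →
      ⊨ φ′ [ collate (b ∘ toℕ) ⌢ c ] ⇔ ⊨ φ [ spread b ⌢ c ])
  truncate {Y = Y} {Z} φ = n , reassign φ σ , λ b c → reassign-⇔ _ _ [] [] φ σ (ev b c)
    where
    index : ∃ (ω-Copies Y ∪ Z) → ℕ
    index (s , inj₁ (i , _)) = i
    index (s , inj₂ _)       = 0

    n  = proj₁ (bounded index (support φ))
    lt = proj₂ (bounded index (support φ))

    σ : Assignment {L = L} {Δ = []} (support φ)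
    σ s (inj₁ (i , y)) x∈ = inj₁ (inj₁ (fromℕ< (lt _ x∈) , y))
    σ s (inj₂ z)       x∈ = inj₁ (inj₂ z)

    ev : ∀ b c → Evaluates (spread b ⌢ c) (collate (b ∘ toℕ) ⌢ c) [] (support φ) σ
    ev b c s (inj₁ (i , y)) x∈ = cong (λ j → b j s y) (toℕ-fromℕ< (lt _ x∈))
    ev b c s (inj₂ z)       x∈ = refl

-- Existential quantification over a possibly infinite block.

module Projection (em : ∀ {p} → ExcludedMiddle p) {ℓ} {L : Language ℓ} where
  open Language L
  open Syntax L

  module _ {v w} {X : Vars v} {Y : Vars w} (φ : Formula (X ∪ Y)) where
    private
      Δ = map proj₁ (support φ)

      -- em makes the bound variable depend on x only, not on its occurrence.
      σ : Assignment {L = L} {W = Y} {Δ} (support φ)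
      σ s (inj₁ x) x∈ with em {P = (s , inj₁ x) ∈ˡ support φ}
      ... | yes x∈′ = inj₂ (∈-map⁺ proj₁ x∈′)
      ... | no  x∉  = ⊥-elim (x∉ x∈)
      σ s (inj₂ y) x∈ = inj₁ y

    -- The prefix has one binder for each entry of the support. Variables of `Y` stay free, so the
    -- binders arising from them are vacuous.
    ∃ˣ : Formula Y
    ∃ˣ = exs Δ (reassign φ σ)

    module _ {m} (N : Structure L m) where
      open Structure N
      open Semantics N
      open Truth N

      ∃ˣ-intro : ∀ (a : Tuple X) (b : Tuple Y) → ⊨ φ [ a ⌢ b ] → ⊨ ∃ˣ [ b ]
      ∃ˣ-intro a b h = Equivalence.from (exs-⇔ b Δ _)
        (δ , Equivalence.from (reassign-⇔ _ b δ [] φ σ ev) h)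
        where
        values : (xs : List (∃ (X ∪ Y))) → All Carrier (map proj₁ xs)
        values []             = []
        values ((s , x) ∷ xs) = (a ⌢ b) s x ∷ values xs

        lookup-values : ∀ xs s x (x∈ : (s , x) ∈ˡ xs) → All.lookup (values xs) (∈-map⁺ proj₁ x∈) ≡ (a ⌢ b) s x
        lookup-values (_ ∷ xs) s x (here refl) = refl
        lookup-values (_ ∷ xs) s x (there x∈)  = lookup-values xs s x x∈

        δ = values (support φ)

        ev : Evaluates (a ⌢ b) b δ (support φ) σ
        ev s (inj₁ x) x∈ with em {P = (s , inj₁ x) ∈ˡ support φ}
        ... | yes x∈′ = lookup-values _ s (inj₁ x) x∈′
        ... | no  x∉  = ⊥-elim (x∉ x∈)
        ev s (inj₂ y) x∈ = refl

      -- Sorts may be empty, so d supplies the values of the variables in X that do not occur.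
      ∃ˣ-elim : ∀ (d : Tuple X) (b : Tuple Y) → ⊨ ∃ˣ [ b ] → Σ[ a ∈ Tuple X ] ⊨ φ [ a ⌢ b ]
      ∃ˣ-elim d b h with Equivalence.to (exs-⇔ b Δ _) h
      ... | δ , h′ = a , Equivalence.to (reassign-⇔ _ b δ [] φ σ ev) h′
        where
        a : Tuple X
        a s x with em {P = (s , inj₁ x) ∈ˡ support φ}
        ... | yes x∈ = All.lookup δ (∈-map⁺ proj₁ x∈)
        ... | no  _  = d s x

        ev : Evaluates (a ⌢ b) b δ (support φ) σ
        ev s (inj₁ x) x∈ with em {P = (s , inj₁ x) ∈ˡ support φ}
        ... | yes x∈′ = refl
        ... | no  x∉  = ⊥-elim (x∉ x∈)
        ev s (inj₂ y) x∈ = refl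

-- Parameter sets replaced by enumerating tuples.

module Proof (em : ∀ {p} → ExcludedMiddle p)
  {ℓ m} {L : Language ℓ} {T : CompleteTheory L m} (𝕄 : BigModel T) where
  open Independence 𝕄
  open CompleteTheory T using (Axioms)
  open BigModel 𝕄
  open Language L
  open Structure M
  open Truth M
  open Ramsey em
  open Projection em
  open Equivalence using () renaming (to to forth; from to back)

  ⟨⟩-⇔ : ∀ {v w} {X : Vars v} {Z : Vars w} (D : Subset) {c : Tuple Z} (c∈D : c ∈ᵗ D) (a : Tuple X)
    (φ : Formula (X ∪ Z)) → ⊨ φ [ a ⌢ c ] ⇔ ⊨ φ ⟨ c , c∈D ⟩ [ a ⌢ name D ]
  ⟨⟩-⇔ D c∈D a = rename-⇔ λ { s (inj₁ x) → refl ; s (inj₂ z) → refl }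

  -- Constants become variables of an enumerating block, so types over `D` reduce to truth of
  -- parameter-free formulas at `c`.
  unname : ∀ {v} {V : Vars v} {Z : Vars ℓ} {D : Subset} {c : Tuple Z} → D ⊆ entries c →
    FormulaOver V D → Formula (V ∪ Z)
  unname D⊆c = rename (λ s → map₂ (λ (x , x∈D) → proj₁ (D⊆c x∈D)))

  unname-⇔ : ∀ {v} {V : Vars v} {Z : Vars ℓ} {D : Subset} {c : Tuple Z} (D⊆c : D ⊆ entries c)
    (a : Tuple V) (φ : FormulaOver V D) →
    ⊨ φ [ a ⌢ name D ] ⇔ ⊨ unname D⊆c φ [ a ⌢ c ]
  unname-⇔ D⊆c a = rename-⇔ λ { s (inj₁ x) → refl ; s (inj₂ (x , x∈D)) → proj₂ (D⊆c x∈D) }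

  -- One implication is enough, since `i` and `j` can be exchanged.
  Indiscernible : ∀ {v w} {Y : Vars v} {Z : Vars w} → Tuple Z → (ℕ → Tuple Y) → Set (ℓ ⊔ m ⊔ v ⊔ w)
  Indiscernible {Y = Y} {Z} c b = ∀ {n} (θ : Formula (Copies n Y ∪ Z)) {i j} →
    Increasing i → Increasing j →
    ⊨ θ [ collate (b ∘ i) ⌢ c ] → ⊨ θ [ collate (b ∘ j) ⌢ c ]

  indiscernible⇒over : ∀ {v} {Y : Vars v} {Z : Vars ℓ} {b : ℕ → Tuple Y} {c : Tuple Z} {D : Subset} →
    D ⊆ entries c → Indiscernible c b → IndiscernibleOver D b
  indiscernible⇒over {Y = Y} {b = b} {D = D} D⊆c ind n i j i↑ j↑ =
    (λ {φ} → along i↑ j↑ {φ}) , (λ {φ} → along j↑ i↑ {φ})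
    where
    along : ∀ {i j : Fin n → ℕ} → Increasing i → Increasing j →
      tp (collate (b ∘ i)) D ⊆ tp (collate (b ∘ j)) D
    along i↑ j↑ {φ} (lift h) =
      lift (back (unname-⇔ D⊆c _ φ) (ind (unname D⊆c φ) i↑ j↑ (forth (unname-⇔ D⊆c _ φ) h)))

  over⇒indiscernible : ∀ {v w} {Y : Vars v} {Z : Vars w} {b : ℕ → Tuple Y} {c : Tuple Z} {D : Subset} →
    c ∈ᵗ D → IndiscernibleOver D b → Indiscernible c b
  over⇒indiscernible {c = c} {D} c∈D over θ {i} {j} i↑ j↑ h =
    back (⟨⟩-⇔ D c∈D _ θ)
      (lower (proj₁ (over _ i j i↑ j↑) {θ ⟨ c , c∈D ⟩} (lift (forth (⟨⟩-⇔ D c∈D _ θ) h))))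

  indiscernible-image : ∀ {v w} {Y : Vars v} {Z : Vars w} {b b′ : ℕ → Tuple Y} {c c′ : Tuple Z}
    (f : Automorphism) → (∀ i s y → to f s (b i s y) ≡ b′ i s y) → (∀ s z → to f s (c s z) ≡ c′ s z) →
    Indiscernible c b → Indiscernible c′ b′
  indiscernible-image {b = b} {b′} {c} {c′} f fb fc ind θ {i} {j} i↑ j↑ =
    forth (moved j) ∘ ind θ i↑ j↑ ∘ back (moved i)
    where
    moved : ∀ i → ⊨ θ [ collate (b ∘ i) ⌢ c ] ⇔ ⊨ θ [ collate (b′ ∘ i) ⌢ c′ ]
    moved i = automorphism-⇔ f (λ { s (inj₁ (k , y)) → fb (i k) s y ; s (inj₂ z) → fc s z }) θ

  -- Consequences of saturation and strong homogeneity.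

  abstract
    -- Saturation over the set `entries d`, applied to the formulas of `p` with `d` substituted for
    -- the variables in `V`.
    compactness : ∀ {X V : Vars ℓ} (d : Tuple V) (p : Pred (Formula (X ∪ V)) (ℓ ⊔ m)) →
      (∀ φs → All p φs → Σ[ a ∈ Tuple X ] All (λ φ → ⊨ φ [ a ⌢ d ]) φs) →
      Σ[ a ∈ Tuple X ] (∀ φ → p φ → ⊨ φ [ a ⌢ d ])
    compactness {X} {V} d p finSat =
      let a , real = saturated X (entries d) (V , d , id , id) p′ finSat′
      in a , λ φ φ∈p → back (⟨⟩-⇔ (entries d) d∈ a φ) (real _ (φ , φ∈p , refl))
      where
      d∈ : d ∈ᵗ entries d
      d∈ s v = v , refl

      p′ : PartialType X (entries d)
      p′ χ = Σ[ φ ∈ Formula (X ∪ V) ] p φ × χ ≡ φ ⟨ d , d∈ ⟩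

      preimages : ∀ {χs} → All p′ χs → Σ[ φs ∈ List (Formula (X ∪ V)) ] All p φs ×
        (∀ a → All (λ φ → ⊨ φ [ a ⌢ d ]) φs → All (λ χ → ⊨ χ [ a ⌢ name (entries d) ]) χs)
      preimages []                       = [] , [] , λ _ _ → []
      preimages ((φ , φ∈p , refl) ∷ ps) with preimages ps
      ... | φs , φs∈p , sat = φ ∷ φs , φ∈p ∷ φs∈p , λ { a (h ∷ hs) → forth (⟨⟩-⇔ (entries d) d∈ a φ) h ∷ sat a hs }

      finSat′ : FinitelySatisfiable p′
      finSat′ χs χs∈p′ with preimages χs∈p′
      ... | φs , φs∈p , sat with finSat φs φs∈p
      ... | a , hs = a , sat a hs

    -- Negation turns the assumed implication into equality of types, and appending `c` to both
    -- tuples makes the automorphism fix it.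
    homogeneousOver : ∀ {Y Z : Vars ℓ} {a b : Tuple Y} {c : Tuple Z} →
      (∀ (φ : Formula (Y ∪ Z)) → ⊨ φ [ a ⌢ c ] → ⊨ φ [ b ⌢ c ]) →
      Σ[ f ∈ Automorphism ] (∀ s y → to f s (b s y) ≡ a s y) × (∀ s z → to f s (c s z) ≡ c s z)
    homogeneousOver {Y} {Z} {a} {b} {c} a⇒b =
      let f , eq = homogeneous (Y ∪ Z) (b ⌢ c) (a ⌢ c) (λ φ → mk⇔ (b⇒a φ) (a⇒b φ))
      in f , (λ s → eq s ∘ inj₁) , (λ s → eq s ∘ inj₂)
      where
      b⇒a : ∀ φ → ⊨ φ [ b ⌢ c ] → ⊨ φ [ a ⌢ c ]
      b⇒a φ φb with em {P = ⊨ φ [ a ⌢ c ]}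
      ... | yes φa = φa
      ... | no ¬φa = Polymorphic.⊥-elim (a⇒b (φ ⇒ ⊥ᶠ) (⊥-elim ∘ ¬φa) φb)

  -- Extraction of indiscernible sequences.

  place : ∀ {v w} {Y : Vars v} {Z : Vars w} {n} → (Fin n → ℕ) →
    Formula (Copies n Y ∪ Z) → Formula (ω-Copies Y ∪ Z)
  place i = rename (λ s → map₁ (λ (k , y) → i k , y))

  place-⇔ : ∀ {v w} {Y : Vars v} {Z : Vars w} {n} (b : ℕ → Tuple Y) (c : Tuple Z) (i : Fin n → ℕ)
    (θ : Formula (Copies n Y ∪ Z)) →
    ⊨ θ [ collate (b ∘ i) ⌢ c ] ⇔ ⊨ place i θ [ spread b ⌢ c ]
  place-⇔ b c i = rename-⇔ λ { s (inj₁ _) → refl ; s (inj₂ _) → refl }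

  abstract
    -- `b′` realises every formula that holds along all sufficiently homogeneous subsequences of
    -- `b`. The last component says that it keeps the Ehrenfeucht-Mostowski type over `c`.
    extract : ∀ {Y Z : Vars ℓ} (b : ℕ → Tuple Y) (c : Tuple Z) →
      Σ[ b′ ∈ (ℕ → Tuple Y) ] Indiscernible c b′ ×
        (∀ {n} (θ : Formula (Copies n Y ∪ Z)) →
          (∀ {i} → Increasing i → ⊨ θ [ collate (b ∘ i) ⌢ c ]) →
          (∀ {i} → Increasing i → ⊨ θ [ collate (b′ ∘ i) ⌢ c ]))
    extract {Y} {Z} b c = (λ i s y → e s (i , y)) ,
      (λ θ {i} {j} i↑ j↑ → back (place-⇔ _ c j θ) ∘
        real (place i θ ⇒ place j θ) ((_ , θ) ∷ [] , λ { g _ (hom ∷ []) →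
          forth (place-⇔ (b ∘ g) c j θ) ∘ hom i j i↑ j↑ ∘ back (place-⇔ (b ∘ g) c i θ) })
        ∘ forth (place-⇔ _ c i θ)) ,
      (λ θ hs {i} i↑ → back (place-⇔ _ c i θ)
        (real (place i θ) ([] , λ g g↑ _ → forth (place-⇔ (b ∘ g) c i θ) (hs (g↑ ∘ i↑)))))
      where
      Coloured : (∃[ n ] Formula (Copies n Y ∪ Z)) → (ℕ → ℕ) → Set m
      Coloured (_ , θ) = Homogeneous (λ i → ⊨ θ [ collate (b ∘ i) ⌢ c ])

      -- Ramsey's theorem is applied to one formula at a time; thinning further keeps the
      -- homogeneity already reached.
      homogenise : ∀ Θ → ∃[ g ] Monotone g × All (λ θ → Coloured θ g) Θ
      homogenise [] = id , id , []
      homogenise ((n , θ) ∷ Θ) with homogenise Θ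
      ... | g , g↑ , homs with ramsey n (λ i → ⊨ θ [ collate (b ∘ g ∘ i) ⌢ c ])
                           (λ i≗j → forth (cong-⇔ (λ { s (inj₁ (k , y)) → cong (λ t → b (g t) s y) (i≗j k)
                                                ; s (inj₂ z) → refl }) θ))
      ... | h , h↑ , hom = g ∘ h , g↑ ∘ h↑ ,
        hom ∷ All.map (λ hom′ i j i↑ j↑ → hom′ (h ∘ i) (h ∘ j) (λ k<l → h↑ (i↑ k<l)) (λ k<l → h↑ (j↑ k<l))) homs

      -- Finitely satisfiable by Ramsey's theorem.  It contains the
      -- Ehrenfeucht–Mostowski type of b over c (with Θ empty) as well as the
      -- formulas expressing indiscernibility (with Θ a singleton).
      eventually : Pred (Formula (ω-Copies Y ∪ Z)) (ℓ ⊔ m)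
      eventually χ = Σ[ Θ ∈ List (∃[ n ] Formula (Copies n Y ∪ Z)) ]
        (∀ g → Monotone g → All (λ θ → Coloured θ g) Θ → ⊨ χ [ spread (b ∘ g) ⌢ c ])

      merge : ∀ {χs} → All eventually χs → Σ[ Θ ∈ List (∃[ n ] Formula (Copies n Y ∪ Z)) ]
        (∀ g → Monotone g → All (λ θ → Coloured θ g) Θ → All (λ χ → ⊨ χ [ spread (b ∘ g) ⌢ c ]) χs)
      merge []             = [] , λ _ _ _ → []
      merge ((Θ , h) ∷ ps) with merge ps
      ... | Θ′ , hs = Θ ++ Θ′ , λ g g↑ homs → h g g↑ (++⁻ˡ Θ homs) ∷ hs g g↑ (++⁻ʳ Θ homs)

      realised : Σ[ e ∈ Tuple (ω-Copies Y) ] (∀ χ → eventually χ → ⊨ χ [ e ⌢ c ])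
      realised = compactness c eventually λ χs ps →
        let Θ , hs = merge ps
            g , g↑ , homs = homogenise Θ
        in spread (b ∘ g) , hs g g↑ homs

      e : Tuple (ω-Copies Y)
      e = proj₁ realised

      real : ∀ χ → eventually χ → ⊨ χ [ e ⌢ c ]
      real = proj₂ realised

  -- From Shelah-dividing independence to `Ξ`-dividing independence.

  const↑ : ∀ {t} → Increasing {1} (λ _ → t)
  const↑ {x = zero} {zero} ()

  d⇒Ξ : ∀ {A B C} → Small C → A ⊥ᵈ[ C ] B → A ⊥Ξ[ C ] B
  d⇒Ξ {A} {B} {C} (Z , c , C⊆c , c⊆C) A⊥B
    (X , a , a∈A , Y , ξ , (b , b∈) , lift φ⟨b⟩ , d , d-tp , d-ψ) =
    witness M isModel a′ (b″ ∘ toℕ) ((λ i → φ-a′ (toℕ i)) , ψ-b″)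
    where
    open Ξ ξ

    c∈C : c ∈ᵗ C
    c∈C s z = c⊆C (z , refl)

    extracted = extract d c
    b′ = proj₁ extracted
    limit = proj₂ (proj₂ extracted)

    -- Every `d i` realises the type of `b` over `C`, so `χ` holds at all members of `d` and
    -- survives the extraction.
    same-type : ∀ (χ : Formula (Y ∪ Z)) → ⊨ χ [ b ⌢ c ] → ⊨ χ [ b′ 0 ⌢ c ]
    same-type χ h = back (once (λ _ → b′ 0)) (limit θ
      (λ {i} _ → forth (once (d ∘ i))
        (back (⟨⟩-⇔ C c∈C _ χ) (d-tp (i zero) (χ ⟨ c , c∈C ⟩) (lift (forth (⟨⟩-⇔ C c∈C b χ) h)))))
      {λ _ → 0} const↑)
      where
      θ : Formula (Copies 1 Y ∪ Z)
      θ = rename (λ s → map₁ (zero ,_)) χ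

      once : ∀ (e : Fin 1 → Tuple Y) → ⊨ χ [ e zero ⌢ c ] ⇔ ⊨ θ [ collate e ⌢ c ]
      once e = rename-⇔ (λ { s (inj₁ _) → refl ; s (inj₂ _) → refl }) χ

    -- The automorphism takes `b′ 0` to `b` over `c`, so the moved sequence starts with `b`.
    conj = homogeneousOver same-type
    f   = proj₁ conj
    f-b = proj₁ (proj₂ conj)
    f-c = proj₂ (proj₂ conj)

    b″ : ℕ → Tuple Y
    b″ i s y = to f s (b′ i s y)

    b″-indiscernible : IndiscernibleOver C b″
    b″-indiscernible = indiscernible⇒over {b = b″} C⊆c
      (indiscernible-image {b = b′} {b″} {c} {c} f (λ _ _ _ → refl) f-c (proj₁ (proj₂ extracted)))

    independent = A⊥B Y b″ b″-indiscernible
      (λ s y → subst (λ x → (s , x) ∈ B ∪ C) (sym (f-b s y)) (b∈ s y))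
    A′    = proj₁ independent
    h     = proj₁ (proj₁ (proj₂ independent))
    h-fix = proj₁ (proj₂ (proj₁ (proj₂ independent)))
    A⊆hA′ = proj₂ (proj₂ (proj₂ (proj₁ (proj₂ independent))))

    a′ : Tuple X
    a′ s x = proj₁ (A⊆hA′ (a∈A s x))

    b″-indiscernible-a′ : Indiscernible a′ b″
    b″-indiscernible-a′ = over⇒indiscernible {b = b″}
      (λ s x → inj₁ (proj₁ (proj₂ (A⊆hA′ (a∈A s x))))) (proj₂ (proj₂ independent))

    -- The instance at `b″ 0` is pulled back along `h` from the one at `a` and `b`; indiscernibility
    -- over `a′` carries it to every `i`.
    φ-a′ : ∀ i → ⊨ φ [ a′ ⌢ b″ i ]
    φ-a′ i = back (once (b″ i)) (b″-indiscernible-a′ θ {λ _ → 0} {λ _ → i} const↑ const↑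
      (forth (once (b″ 0)) (back (automorphism-⇔ h h-a′b″ φ) (back (⟨⟩-⇔ (B ∪ C) b∈ a φ) φ⟨b⟩))))
      where
      θ : Formula (Copies 1 Y ∪ X)
      θ = rename (λ s → [ inj₂ , (λ y → inj₁ (zero , y)) ]) φ

      once : ∀ e → ⊨ φ [ a′ ⌢ e ] ⇔ ⊨ θ [ collate (λ _ → e) ⌢ a′ ]
      once e = rename-⇔ (λ { s (inj₁ _) → refl ; s (inj₂ _) → refl }) φ

      h-a′b″ : ∀ s x → to h s ((a′ ⌢ b″ 0) s x) ≡ (a ⌢ b) s x
      h-a′b″ s (inj₁ x) = proj₂ (proj₂ (A⊆hA′ (a∈A s x)))
      h-a′b″ s (inj₂ y) = trans (h-fix s _ (inj₂ (y , refl))) (f-b s y)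

    -- `ψ` holds at all increasing `k`-tuples of `d`, hence of `b′`, and the automorphism `f`
    -- preserves it.
    ψ-b″ : ⊨ ψ [ collate (b″ ∘ toℕ) ]
    ψ-b″ = forth (automorphism-⇔ {a = collate (b′ ∘ toℕ)} f (λ _ _ → refl) ψ)
      (back (weaken _) (limit θ (λ {i} i↑ → forth (weaken _) (d-ψ i i↑)) {toℕ} id))
      where
      θ : Formula (Copies k Y ∪ Z)
      θ = rename (λ s → inj₁) ψ

      weaken : ∀ e → ⊨ ψ [ e ] ⇔ ⊨ θ [ e ⌢ c ]
      weaken e = rename-⇔ (λ _ _ → refl) ψ

  -- From `Ξ`-dividing independence to Shelah-dividing independence.

  module _ {A B C} (A-small : Small A) (C-small : Small C) (A⊥B : A ⊥Ξ[ C ] B)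
    {Y : Vars ℓ} (b : ℕ → Tuple Y) (b-over : IndiscernibleOver C b) (b₀∈ : b 0 ∈ᵗ (B ∪ C)) where
    private
      X   = proj₁ A-small
      a   = proj₁ (proj₂ A-small)
      A⊆a = proj₁ (proj₂ (proj₂ A-small))
      a⊆A = proj₂ (proj₂ (proj₂ A-small))
      Z   = proj₁ C-small
      c   = proj₁ (proj₂ C-small)
      C⊆c = proj₁ (proj₂ (proj₂ C-small))
      c⊆C = proj₂ (proj₂ (proj₂ C-small))

      b-ind : Indiscernible c b
      b-ind = over⇒indiscernible {b = b} (λ s z → c⊆C (z , refl)) b-over

      -- Pairs in `Ξ` are parameter-free, so the enumeration of `C` is appended to every member of
      -- the sequence.
      bc : ℕ → Tuple (Y ∪ Z)
      bc i = b i ⌢ c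

    module _ (φ : Formula (X ∪ (Y ∪ Z))) (k : ℕ) where
      conjunction : Formula (X ∪ Copies k (Y ∪ Z))
      conjunction = ⋀ k (λ i → rename (λ s → map₂ (i ,_)) φ)

      conjunction-⇔ : ∀ (N : Structure L m) → let module N = Semantics N in
        (a′ : N.Tuple X) (e : Fin k → N.Tuple (Y ∪ Z)) →
        N.⊨ conjunction [ a′ N.⌢ N.collate e ] ⇔ (∀ i → N.⊨ φ [ a′ N.⌢ e i ])
      conjunction-⇔ N a′ e = Π-⇔ (↠-id _) (λ {i} → ⇔-sym (Truth.rename-⇔ N
        (λ { s (inj₁ _) → refl ; s (inj₂ _) → refl }) φ)) ⇔-∘ Truth.⋀-⇔ N _ k _

      inconsistency : Ξ X (Y ∪ Z)
      inconsistency = record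
        { φ = φ ; k = k ; ψ = ∃ˣ conjunction ⇒ ⊥ᶠ
        ; witness = λ N _ a′ e (φs , ¬∃) →
            Polymorphic.⊥-elim (¬∃ (∃ˣ-intro conjunction N a′ _ (back (conjunction-⇔ N a′ e) φs)))
        }

      -- Indiscernibility over `c` gives all `bc i` the same type over `C` and spreads the failure
      -- at the first `k` members to every increasing `k`-tuple.
      divides : ¬ (Σ[ a′ ∈ Tuple X ] (∀ (i : Fin k) → ⊨ φ [ a′ ⌢ bc (toℕ i) ])) →
        (inconsistency -dividesOver) (bc 0) C
      divides ¬sat = bc , bc-tp , bc-ψ
        where
        bc-tp : ∀ i → bc i realises tp (bc 0) C
        bc-tp i χ (lift h) =
          back (once i) (b-ind θ {λ _ → 0} {λ _ → i} const↑ const↑ (forth (once 0) h))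
          where
          θ : Formula (Copies 1 Y ∪ Z)
          θ = rename (λ s → [ map₁ (zero ,_) , (λ (x , x∈C) → inj₂ (proj₁ (C⊆c x∈C))) ]) χ

          once : ∀ t → ⊨ χ [ bc t ⌢ name C ] ⇔ ⊨ θ [ collate (λ _ → b t) ⌢ c ]
          once t = rename-⇔ (λ { s (inj₁ (inj₁ _)) → refl ; s (inj₁ (inj₂ _)) → refl
                               ; s (inj₂ (x , x∈C)) → proj₂ (C⊆c x∈C) }) χ

        ψ : Formula (Copies k (Y ∪ Z))
        ψ = ∃ˣ conjunction ⇒ ⊥ᶠ

        bc-ψ : ∀ i → Increasing i → ⊨ ψ [ collate (bc ∘ i) ]
        bc-ψ i i↑ = back (shared i) (b-ind θ {toℕ} {i} id i↑ (forth (shared toℕ) λ h →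
          -- `a` serves as the default value for variables that do not occur.
          let a′ , h′ = ∃ˣ-elim conjunction M a (collate (bc ∘ toℕ)) h
          in ⊥-elim (¬sat (a′ , forth (conjunction-⇔ M a′ (bc ∘ toℕ)) h′))))
          where
          θ : Formula (Copies k Y ∪ Z)
          θ = rename (λ s (k , v) → map₁ (k ,_) v) ψ

          shared : ∀ i → ⊨ ψ [ collate (bc ∘ i) ] ⇔ ⊨ θ [ collate (b ∘ i) ⌢ c ]
          shared i = rename-⇔ (λ { s (_ , inj₁ _) → refl ; s (_ , inj₂ _) → refl }) ψ

      -- Otherwise `divides` would yield a dividing formula in the type of `a` over `B ∪ C`.
      satisfiable : ⊨ φ [ a ⌢ bc 0 ] →
        Σ[ a′ ∈ Tuple X ] (∀ i → i < k → ⊨ φ [ a′ ⌢ bc i ])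
      satisfiable φa with em {P = Σ[ a′ ∈ Tuple X ] (∀ (i : Fin k) → ⊨ φ [ a′ ⌢ bc (toℕ i) ])}
      ... | yes (a′ , hs) = a′ , λ i i<k →
        subst (λ j → ⊨ φ [ a′ ⌢ bc j ]) (toℕ-fromℕ< i<k) (hs (fromℕ< i<k))
      ... | no ¬sat = ⊥-elim (A⊥B (X , a , (λ s x → a⊆A (x , refl)) , (Y ∪ Z) , inconsistency ,
        (bc 0 , bc₀∈) , lift (forth (⟨⟩-⇔ (B ∪ C) bc₀∈ a φ) φa) , divides ¬sat))
        where
        bc₀∈ : bc 0 ∈ᵗ (B ∪ C)
        bc₀∈ s (inj₁ y) = b₀∈ s y
        bc₀∈ s (inj₂ z) = inj₂ (c⊆C (z , refl))

    -- The union of the types over all members, closed under consequences of finitely many instances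
    -- of one formula. Finite subsets then merge by a conjunction and the bound `k + k′`.
    copies : Pred (Formula (X ∪ (ω-Copies Y ∪ Z))) (ℓ ⊔ m)
    copies χ = Σ[ φ ∈ Formula (X ∪ (Y ∪ Z)) ] ∃[ k ] ⊨ φ [ a ⌢ bc 0 ] ×
      (∀ a′ → (∀ i → i < k → ⊨ φ [ a′ ⌢ bc i ]) → ⊨ χ [ a′ ⌢ spread b ⌢ c ])

    copies-merge : ∀ {χs} → All copies χs → Σ[ φ ∈ Formula (X ∪ (Y ∪ Z)) ] ∃[ k ] ⊨ φ [ a ⌢ bc 0 ] ×
      (∀ a′ → (∀ i → i < k → ⊨ φ [ a′ ⌢ bc i ]) → All (λ χ → ⊨ χ [ a′ ⌢ spread b ⌢ c ]) χs)
    copies-merge [] = ⊤ᶠ , 0 , id , λ _ _ → []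
    copies-merge ((φ , k , φa , h) ∷ ps) with copies-merge ps
    ... | φ′ , k′ , φ′a , hs = φ ∧ φ′ , k + k′ , (φa , φ′a) , λ a′ sat →
      h a′ (λ i i<k → proj₁ (sat i (<-≤-trans i<k (m≤m+n k k′)))) ∷
      hs a′ (λ i i<k′ → proj₂ (sat i (<-≤-trans i<k′ (m≤n+m k′ k))))

    common : Σ[ a* ∈ Tuple X ] (∀ φ → ⊨ φ [ a ⌢ bc 0 ] → ∀ i → ⊨ φ [ a* ⌢ bc i ])
    common =
      let a* , real = compactness (spread b ⌢ c) copies λ χs ps →
            let φ , k , φa , hs = copies-merge ps
                a′ , sat = satisfiable φ k φa
            in a′ , hs a′ sat
      in a* , λ φ φa i → back (at i φ a*) 
        -- The first `suc i` instances include the one with index `i`.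
        (real (copy i φ) (φ , suc i , φa , λ a′ sat → forth (at i φ a′) (sat i (n<1+n i))))
      where
      copy : ℕ → Formula (X ∪ (Y ∪ Z)) → Formula (X ∪ (ω-Copies Y ∪ Z))
      copy i = rename (λ s → map₂ (map₁ (i ,_)))

      at : ∀ i φ a′ → ⊨ φ [ a′ ⌢ bc i ] ⇔ ⊨ copy i φ [ a′ ⌢ spread b ⌢ c ]
      at i φ a′ = rename-⇔ (λ { s (inj₁ _) → refl ; s (inj₂ (inj₁ _)) → refl ; s (inj₂ (inj₂ _)) → refl }) φ

    conjugate : Σ[ A′ ∈ Subset ] A′ ≡[ C ∪ entries (b 0) ] A × IndiscernibleOver (A′ ∪ C) b
    conjugate = entries a′ ,
      (h , (λ { s x (inj₁ x∈C) → h-C s x (C⊆c x∈C) ; s x (inj₂ (y , refl)) → h-bc s (inj₁ y) }) ,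
        (λ { (x , (v , refl) , refl) → a⊆A (v , sym (h-a _ v)) }) ,
        (λ x∈A → image⊇ (A⊆a x∈A))) ,
      indiscernible⇒over {b = b}
        (λ { (inj₁ (v , eq)) → inj₁ v , eq ; (inj₂ x∈C) → let z , eq = C⊆c x∈C in inj₂ z , eq })
        (indiscernible-image {b = b″} {b} {a* ⌢ c} {a′ ⌢ c} f (λ i s y → f-b s (i , y))
          (λ { s (inj₁ _) → refl ; s (inj₂ z) → f-c s z }) (proj₁ (proj₂ extracted)))
      where
      a*   = proj₁ common
      a*-φ = proj₂ common

      extracted = extract b (a* ⌢ c)
      b″    = proj₁ extracted
      limit = proj₂ (proj₂ extracted)

      -- After truncation, indiscernibility of `b` over `c` makes `χ′` true at all increasing tuples
      -- of `b`, so the extraction passes it on to `b″`.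
      same-type : ∀ χ → ⊨ χ [ spread b ⌢ c ] → ⊨ χ [ spread b″ ⌢ c ]
      same-type χ h with truncate χ
      ... | n , χ′ , χ′⇔χ = forth (χ′⇔χ b″ c) (back (weaken _) (limit θ
          (λ {i} i↑ → forth (weaken _) (b-ind χ′ {toℕ} {i} id i↑ (back (χ′⇔χ b c) h))) {toℕ} id))
        where
        θ : Formula (Copies n Y ∪ (X ∪ Z))
        θ = rename (λ s → map₂ inj₂) χ′

        weaken : ∀ e → ⊨ χ′ [ e ⌢ c ] ⇔ ⊨ θ [ e ⌢ a* ⌢ c ]
        weaken e = rename-⇔ (λ { s (inj₁ _) → refl ; s (inj₂ _) → refl }) χ′

      -- This automorphism takes the whole sequence `b″` back to `b` over `c`.
      moved = homogeneousOver same-type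
      f   = proj₁ moved
      f-b = proj₁ (proj₂ moved)
      f-c = proj₂ (proj₂ moved)

      a′ : Tuple X
      a′ s x = to f s (a* s x)

      -- `a*` satisfies `φ` with every member of `b`, hence with `b″ 0` after the extraction, and
      -- `f` moves this to `a′` and `b 0`.
      a′-type : ∀ φ → ⊨ φ [ a ⌢ bc 0 ] → ⊨ φ [ a′ ⌢ bc 0 ]
      a′-type φ φa = forth (automorphism-⇔ f f-a*b″ φ)
        (back (once (λ _ → b″ 0)) (limit θ (λ {i} _ → forth (once (b ∘ i)) (a*-φ φ φa (i zero))) {λ _ → 0} const↑))
        where
        f-a*b″ : ∀ s x → to f s ((a* ⌢ b″ 0 ⌢ c) s x) ≡ (a′ ⌢ bc 0) s x
        f-a*b″ s (inj₁ x)        = refl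
        f-a*b″ s (inj₂ (inj₁ y)) = f-b s (0 , y)
        f-a*b″ s (inj₂ (inj₂ z)) = f-c s z

        θ : Formula (Copies 1 Y ∪ (X ∪ Z))
        θ = rename (λ s → [ inj₂ ∘ inj₁ , map₁ (zero ,_) ∘ map₂ inj₂ ]) φ

        once : ∀ (e : Fin 1 → Tuple Y) → ⊨ φ [ a* ⌢ e zero ⌢ c ] ⇔ ⊨ θ [ collate e ⌢ a* ⌢ c ]
        once e = rename-⇔ (λ { s (inj₁ _) → refl ; s (inj₂ (inj₁ _)) → refl ; s (inj₂ (inj₂ _)) → refl }) φ

      -- This automorphism takes `a′` to `a` and fixes `b 0` and `c`, which is the conjugacy
      -- required of `A′`.
      return = homogeneousOver a′-type
      h    = proj₁ return
      h-a  = proj₁ (proj₂ return)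
      h-bc = proj₂ (proj₂ return)

      h-C : ∀ s x → (s , x) ∈ entries c → to h s x ≡ x
      h-C s _ (z , refl) = h-bc s (inj₂ z)

      image⊇ : ∀ {s x} → (s , x) ∈ entries a → (s , x) ∈ image h (entries a′)
      image⊇ (v , refl) = a′ _ v , (v , refl) , h-a _ v

proposition2p31 : (em : ∀ {p} → ExcludedMiddle p) →
    ∀ {ℓ m} {L : Language ℓ} {T : CompleteTheory L m} (𝕄 : BigModel T) →
    let open Independence 𝕄 in
    ∀ (A B C : Subset) → Small A → Small B → Small C →
    A ⊥ᵈ[ C ] B ⇔ A ⊥Ξ[ C ] B
proposition2p31 em 𝕄 A B C A-small _ C-small = mk⇔ (d⇒Ξ C-small)
  (λ A⊥B Y b b-over b₀∈ → conjugate A-small C-small A⊥B b b-over b₀∈)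
  where open Proof em 𝕄
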